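{- Let $T$ be a propositional theory over $\mathcal V$, let $(\mathcal A,\oplus,\otimes,e^\oplus,e^\otimes)$ be a commutative semiring, and let $\alpha:\mathcal L\to\mathcal A$ be a labeling function on the literals of $\mathcal V$. Assume that $\otimes$ is idempotent ($a\otimes a=a$ for all $a\in\mathcal A$) and that $(\otimes,\alpha)$ is consistency-preserving, i.e. $\alpha(v)\otimes\alpha(\neg v)=e^\oplus$ for all $v\in\mathcal V$. Let $N_T$ be an NNF circuit over $\mathcal V$ logically equivalent to $T$. Then evaluating $N_T$ is a sound AMC computation, i.e. $$\mathrm{Eval}(N_T,\oplus,\otimes,e^\oplus,e^\otimes,\alpha)=\mathbf A(T),$$ in each of the following cases: \begin{itemize} \item $N_T$ is an s-NNF (smooth) whose set of variables is $\mathcal V$, and $\oplus$ is idempotent ($a\oplus a=a$ for all $a\in\mathcal A$); \item $N_T$ is a d-NNF (deterministic), and $(\oplus,\alpha)$ is neutral, i.e. $\alpha(v)\oplus\alpha(\neg v)=e^\otimes$ for all $v\in\mathcal V$; \item $N_T$ is an arbitrary NNF, $\oplus$ is idempotent, and $(\oplus,\alpha)$ is neutral. \end{itemize}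
   Context: A semiring $(\mathcal A,\oplus,\otimes,e^\oplus,e^\otimes)$ has associative binary operations $\oplus,\otimes$ on $\mathcal A$, with $\oplus$ commutative, $\otimes$ distributing over $\oplus$, $e^\oplus$ neutral for $\oplus$, $e^\otimes$ neutral for $\otimes$, and $e^\oplus\otimes a=a\otimes e^\oplus=e^\oplus$ for all $a$. It is commutative if $\otimes$ is also commutative. Algebraic model count: for a propositional theory $T$ over a finite set $\mathcal V$ of variables and $\alpha:\mathcal L\to\mathcal A$ on the set $\mathcal L$ of literals of $\mathcal V$, $$\mathbf A(T)=\bigoplus_{I\in\mathcal M(T)}\ \bigotimes_{l\in I}\alpha(l),$$ where $\mathcal M(T)$ is the set of models of $T$; a model is a set of literals containing exactly one of $v,\neg v$ for each $v\in\mathcal V$. Empty sums are $e^\oplus$, empty products $e^\otimes$. An NNF circuit over $\mathcal V$ is a finite rooted directed acyclic graph whose leaves are labeled with $\top$, $\bot$ or a literal of a variable in $\mathcal V$, and whose internal nodes are labeled $\vee$ or $\wedge$. Each node is identified with the formula of the subcircuit rooted at it, and its variables are those occurring in that subcircuit. The circuit is deterministic if for each disjunction node $\bigvee_{i=1}^n\phi_i$ each two children $\phi_i,\phi_j$ ($i\ne j$) are logically inconsistent; smooth if for each disjunction node all children mention the same set of variables. $\mathrm{Eval}$ is defined recursively from the leaves to the root: $\top\mapsto e^\otimes$, $\bot\mapsto e^\oplus$, literal $l\mapsto\alpha(l)$, a disjunction node $\mapsto$ the $\oplus$-sum of the values of its children, a conjunction node $\mapsto$ the $\otimes$-product of the values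 of its children; the value of the circuit is that of its root. -}

module Defs where

open import Algebra.Bundles using (CommutativeSemiring)
open import Data.Bool.Base as Bool using (Bool; true; false; if_then_else_)
open import Data.Bool.ListAction using (all)
open import Data.Fin.Base using (Fin; zero; suc)
open import Data.Fin.Subset as Subset using (Subset; ⁅_⁆; _∪_)
open import Data.Graph.Acyclic using (Graph; _&_; label; successors)
open import Data.List.Base as List
  using (List; []; _∷_; map; foldr; filterᵇ; allFin; cartesianProductWith)
open import Data.List.Membership.Propositional using (_∈_)
open import Data.List.Relation.Unary.AllPairs using (AllPairs)
open import Data.Nat.Base using (ℕ; zero; suc)
open import Data.Product.Base using (_×_; proj₂)
open import Data.Unit.Base using () renaming (⊤ to Unit)
open import Data.Vec.Base as Vec using (Vec)
open import Function.Base using (_∘_)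
open import Function.Bundles using (_⇔_)
open import Relation.Binary.Construct.Closure.ReflexiveTransitive using (Star)
open import Relation.Binary.PropositionalEquality using (_≡_)
open import Relation.Nullary.Negation using () renaming (¬_ to Not)

data Literal (k : ℕ) : Set where
  pos neg : Fin k → Literal k

infix  8 ¬_
infixr 7 _∧_
infixr 6 _∨_
infixr 5 _⇒_

data Formula (k : ℕ) : Set where
  ⊤ ⊥         : Formula k
  var         : Fin k → Formula k
  ¬_          : Formula k → Formula k
  _∧_ _∨_ _⇒_ : Formula k → Formula k → Formula k

Theory : ℕ → Set
Theory k = List (Formula k)

-- A set of literals containing exactly one of v, ¬v for each variable v is
-- given by the choice made at each v; `literals` recovers the set itself.

Interpretation : ℕ → Set
Interpretation k = Vec Bool k

literals : ∀ {k} → Interpretation k → List (Literal k)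
literals {k} I =
  map (λ v → if Vec.lookup I v then pos v else neg v) (allFin k)

allInterpretations : ∀ k → List (Interpretation k)
allInterpretations zero    = Vec.[] ∷ []
allInterpretations (suc k) =
  cartesianProductWith Vec._∷_ (true ∷ false ∷ []) (allInterpretations k)

⟦_⟧ : ∀ {k} → Formula k → Interpretation k → Bool
⟦ ⊤     ⟧ I = true
⟦ ⊥     ⟧ I = false
⟦ var v ⟧ I = Vec.lookup I v
⟦ ¬ φ   ⟧ I = Bool.not (⟦ φ ⟧ I)
⟦ φ ∧ ψ ⟧ I = ⟦ φ ⟧ I Bool.∧ ⟦ ψ ⟧ I
⟦ φ ∨ ψ ⟧ I = ⟦ φ ⟧ I Bool.∨ ⟦ ψ ⟧ I
⟦ φ ⇒ ψ ⟧ I = Bool.not (⟦ φ ⟧ I) Bool.∨ ⟦ ψ ⟧ I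

⟦_⟧ᵀ : ∀ {k} → Theory k → Interpretation k → Bool
⟦ T ⟧ᵀ I = all (λ φ → ⟦ φ ⟧ I) T

models : ∀ {k} → Theory k → List (Interpretation k)
models {k} T = filterᵇ ⟦ T ⟧ᵀ (allInterpretations k)

Inconsistent : ∀ {k} → Formula k → Formula k → Set
Inconsistent φ ψ = ∀ I → Not (⟦ φ ⟧ I ≡ true × ⟦ ψ ⟧ I ≡ true)

vars : ∀ {k} → Formula k → Subset k
vars ⊤       = Subset.⊥
vars ⊥       = Subset.⊥
vars (var v) = ⁅ v ⁆
vars (¬ φ)   = vars φ
vars (φ ∧ ψ) = vars φ ∪ vars ψ
vars (φ ∨ ψ) = vars φ ∪ vars ψ
vars (φ ⇒ ψ) = vars φ ∪ vars ψ

data Label (k : ℕ) : Set where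
  ⊤ ⊥     : Label k
  literal : Literal k → Label k
  or and  : Label k

data IsLeafLabel {k : ℕ} : Label k → Set where
  ⊤       : IsLeafLabel ⊤
  ⊥       : IsLeafLabel ⊥
  literal : ∀ l → IsLeafLabel (literal l)

-- The library's DAGs are listed in a topological order, parents first, so
-- the root is node zero. Edges carry no information; children form a finite
-- family, so a node may be listed twice (simple graphs are a special case).

DAG : ℕ → ℕ → Set
DAG k n = Graph (Label k) Unit n

labelOf : ∀ {k n} → DAG k n → Fin n → Label k
labelOf (c & g) zero    = label c
labelOf (c & g) (suc i) = labelOf g i

children : ∀ {k n} → DAG k n → Fin n → List (Fin n)
children (c & g) zero    = map (suc ∘ proj₂) (successors c)
children (c & g) (suc i) = map suc (children g i)

record NNF (k : ℕ) : Set where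
  field
    {size} : ℕ
    dag    : DAG k (suc size)
    rooted : ∀ i → Star (λ i j → j ∈ children dag i) zero i
    leaves : ∀ i → children dag i ≡ [] ⇔ IsLeafLabel (labelOf dag i)

bottomUp : ∀ {b} {B : Set b} {k n} →
           (Label k → List B → B) → DAG k n → Fin n → B
bottomUp f (c & g) zero    =
  f (label c) (map (bottomUp f g ∘ proj₂) (successors c))
bottomUp f (c & g) (suc i) = bottomUp f g i

formulaStep : ∀ {k} → Label k → List (Formula k) → Formula k
formulaStep ⊤                 _  = ⊤
formulaStep ⊥                 _  = ⊥
formulaStep (literal (pos v)) _  = var v
formulaStep (literal (neg v)) _  = ¬ var v
formulaStep or                φs = foldr _∨_ ⊥ φs
formulaStep and               φs = foldr _∧_ ⊤ φs

formula : ∀ {k n} → DAG k n → Fin n → Formula k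
formula = bottomUp formulaStep

module _ {k : ℕ} (N : NNF k) where
  open NNF N

  rootFormula : Formula k
  rootFormula = formula dag zero

  Represents : Theory k → Set
  Represents T = ∀ I → ⟦ rootFormula ⟧ I ≡ ⟦ T ⟧ᵀ I

  Deterministic : Set
  Deterministic = ∀ i → labelOf dag i ≡ or →
    AllPairs Inconsistent (map (formula dag) (children dag i))

  Smooth : Set
  Smooth = ∀ i → labelOf dag i ≡ or → ∀ {x y} →
    x ∈ children dag i → y ∈ children dag i →
    vars (formula dag x) ≡ vars (formula dag y)

  MentionsAllVariables : Set
  MentionsAllVariables = vars rootFormula ≡ Subset.⊤

module AMC {c ℓ} (𝒜 : CommutativeSemiring c ℓ) {k : ℕ}
           (α : Literal k → CommutativeSemiring.Carrier 𝒜) where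
  open CommutativeSemiring 𝒜 using (Carrier; _≈_; _+_; _*_; 0#; 1#)

  sum product : List Carrier → Carrier
  sum     = foldr _+_ 0#
  product = foldr _*_ 1#

  amc : Theory k → Carrier
  amc T = sum (map (λ I → product (map α (literals I))) (models T))

  evalStep : Label k → List Carrier → Carrier
  evalStep ⊤           _  = 1#
  evalStep ⊥           _  = 0#
  evalStep (literal l) _  = α l
  evalStep or          xs = sum xs
  evalStep and         xs = product xs

  eval : NNF k → Carrier
  eval N = bottomUp evalStep (NNF.dag N) zero

  ConsistencyPreserving : Set ℓ
  ConsistencyPreserving = ∀ v → α (pos v) * α (neg v) ≈ 0#

  Neutral : Set ℓ
  Neutral = ∀ v → α (pos v) + α (neg v) ≈ 1#

{-# OPTIONS --safe #-}
module Submission where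

-- Write w(I) for the product of the labels of the literals of an
-- interpretation I, and s(v) for α(v) ⊕ α(¬v).
--
-- Multiplying by w(I) evaluates a circuit at I: since ⊗ is idempotent and
-- (⊗,α) is consistency-preserving, w(I) ⊗ α(l) is w(I) if l ∈ I and e^⊕
-- otherwise, and by induction on the circuit w(I) ⊗ Eval(φ) is w(I) if I
-- satisfies φ and e^⊕ otherwise (`weight-eval`). At a disjunction several
-- copies of w(I) may be added up; they collapse when ⊕ is idempotent, and
-- there is at most one copy when the circuit is deterministic.
--
-- Distributivity gives ⨁_I w(I) = ⨂_v s(v) (`sum-weights`). Hence, as soon as
-- Eval(N) ⊗ s(v) = Eval(N) for every variable v,
--
--   Eval(N) = Eval(N) ⊗ ⨂_v s(v) = ⨁_I w(I) ⊗ Eval(N) = ⨁_{I ⊨ N} w(I),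
--
-- which is the algebraic model count (`eval-amc`). The absorption of s(v) is
-- trivial if (⊕,α) is neutral. If the circuit is smooth, every node absorbs
-- s(v) for each variable v that it mentions (`smooth-absorbs`): a literal l of
-- v does because α(l) ⊗ s(v) = α(l) ⊕ e^⊕, a conjunction because one of its
-- children does, and a disjunction because, by smoothness, all of them do.

open import Defs
open import Algebra.Bundles using (CommutativeSemiring)
open import Algebra.Definitions using (Idempotent)
import Algebra.Properties.CommutativeSemigroup as CommutativeSemigroupProperties
open import Data.Bool.Base as Bool using (Bool; true; false; if_then_else_)
open import Data.Fin.Base using (Fin; zero; suc)
import Data.Fin.Subset as Subset
open import Data.Fin.Subset.Properties using (∉⊥; ∈⊤; x∈⁅y⁆⇒x≡y; x∈p∪q⁻)
open import Data.Graph.Acyclic using (_&_; successors)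
open import Data.List.Base
  using (List; []; _∷_; _++_; map; foldr; filterᵇ; allFin; tabulate)
open import Data.List.Membership.Propositional using (_∈_)
open import Data.List.Membership.Propositional.Properties
  using (∈-map⁺; ∈-allFin)
open import Data.List.Properties
  using (map-∘; map-cong; map-tabulate; ++-identityʳ)
open import Data.List.Relation.Unary.All as All using (All; []; _∷_)
import Data.List.Relation.Unary.All.Properties as All
open import Data.List.Relation.Unary.AllPairs using (AllPairs; _∷_)
open import Data.List.Relation.Unary.Any using (here; there)
open import Data.Nat.Base using (ℕ; zero; suc)
open import Data.Product.Base using (_×_; _,_; proj₂; ∃-syntax)
open import Data.Sum.Base as Sum using (_⊎_; inj₁; inj₂)
open import Data.Vec.Base as Vec using ()
open import Function.Base using (_∘_; id)
open import Relation.Binary.PropositionalEquality as ≡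
  using (_≡_; refl; cong; subst)
import Relation.Binary.Reasoning.Setoid as SetoidReasoning
open import Relation.Nullary.Negation using (contradiction)

-- Induction on circuits

-- The recursive equation of `bottomUp` at an arbitrary node, which the
-- definition by recursion on the graph only provides at the first one.
bottomUp-unfold : ∀ {b} {B : Set b} {k n} (f : Label k → List B → B)
  (G : DAG k n) i →
  bottomUp f G i ≡ f (labelOf G i) (map (bottomUp f G) (children G i))
bottomUp-unfold f (c & g) zero    = cong (f _) (map-∘ (successors c))
bottomUp-unfold f (c & g) (suc i) =
  ≡.trans (bottomUp-unfold f g i) (cong (f _) (map-∘ (children g i)))

-- A property of nodes that is inherited from all children holds everywhere.
dag-induction : ∀ {p k n} (G : DAG k n) (P : Fin n → Set p) →
  (∀ i → All P (children G i) → P i) → ∀ i → P i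
dag-induction (c & g) P step = P-all
  where
  P-suc : ∀ i → P (suc i)
  P-suc = dag-induction g (P ∘ suc) (λ i → step (suc i) ∘ All.map⁺)

  P-all : ∀ i → P i
  P-all zero    = step zero (All.map⁺ (All.universal (P-suc ∘ proj₂) (successors c)))
  P-all (suc i) = P-suc i

-- Disjunctions of formulas

inconsistent-⋁ : ∀ {k} (φ : Formula k) {ψs} I → All (Inconsistent φ) ψs →
  ⟦ φ ⟧ I ≡ true → ⟦ foldr _∨_ ⊥ ψs ⟧ I ≡ false
inconsistent-⋁ φ I []                     _   = refl
inconsistent-⋁ φ I (_∷_ {x = ψ} φ⊥ψ φ⊥ψs) φ≡t with ⟦ ψ ⟧ I in ψ≡
... | true  = contradiction (φ≡t , ψ≡) (φ⊥ψ I)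
... | false = inconsistent-⋁ φ I φ⊥ψs φ≡t

∈-vars-⋁ : ∀ {a} {A : Set a} {k} (F : A → Formula k) {v} xs →
  v Subset.∈ vars (foldr _∨_ ⊥ (map F xs)) →
  ∃[ x ] x ∈ xs × v Subset.∈ vars (F x)
∈-vars-⋁ F []       v∈ = contradiction v∈ ∉⊥
∈-vars-⋁ F (x ∷ xs) v∈ with x∈p∪q⁻ (vars (F x)) _ v∈
... | inj₁ v∈x  = x , here refl , v∈x
... | inj₂ v∈xs with ∈-vars-⋁ F xs v∈xs
...   | y , y∈xs , v∈y = y , there y∈xs , v∈y

-- Finite sums and products in a commutative semiring

module SumsAndProducts {c ℓ} (𝒜 : CommutativeSemiring c ℓ) where
  open CommutativeSemiring 𝒜 hiding (zero) renaming (refl to ≈-refl)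
  open SetoidReasoning setoid
  open CommutativeSemigroupProperties *-commutativeSemigroup
    using (xy∙z≈xz∙y)

  -- Definitionally the sum and product used for model counts, but free of
  -- the labeling function.
  Σ Π : List Carrier → Carrier
  Σ = foldr _+_ 0#
  Π = foldr _*_ 1#

  -- The Iverson bracket [b], multiplied by x.
  infix 8 [_]_
  [_]_ : Bool → Carrier → Carrier
  [ b ] x = if b then x else 0#

  -- Multiplication by s fixes x.
  Absorbs : Carrier → Carrier → Set ℓ
  Absorbs s x = x * s ≈ x

  module _ {a} {A : Set a} where

    Σ-cong : {f g : A → Carrier} → (∀ x → f x ≈ g x) →
      ∀ xs → Σ (map f xs) ≈ Σ (map g xs)
    Σ-cong f≈g []       = ≈-refl
    Σ-cong f≈g (x ∷ xs) = +-cong (f≈g x) (Σ-cong f≈g xs)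

    Σ-distribˡ : ∀ y (f : A → Carrier) xs →
      y * Σ (map f xs) ≈ Σ (map (λ x → y * f x) xs)
    Σ-distribˡ y f []       = zeroʳ y
    Σ-distribˡ y f (x ∷ xs) =
      trans (distribˡ y _ _) (+-congˡ (Σ-distribˡ y f xs))

    Σ-++ : ∀ (f : A → Carrier) xs ys →
      Σ (map f (xs ++ ys)) ≈ Σ (map f xs) + Σ (map f ys)
    Σ-++ f []       ys = sym (+-identityˡ _)
    Σ-++ f (x ∷ xs) ys = trans (+-congˡ (Σ-++ f xs ys)) (sym (+-assoc _ _ _))

    Σ-filter : ∀ (p : A → Bool) (f : A → Carrier) xs →
      Σ (map f (filterᵇ p xs)) ≈ Σ (map (λ x → [ p x ] f x) xs)
    Σ-filter p f []       = ≈-refl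
    Σ-filter p f (x ∷ xs) with p x
    ... | true  = +-congˡ (Σ-filter p f xs)
    ... | false = trans (Σ-filter p f xs) (sym (+-identityˡ _))

    Σ-absorbs : ∀ {s} (f : A → Carrier) {xs} →
      All (Absorbs s ∘ f) xs → Absorbs s (Σ (map f xs))
    Σ-absorbs f []       = zeroˡ _
    Σ-absorbs f (p ∷ ps) = trans (distribʳ _ _ _) (+-cong p (Σ-absorbs f ps))

    absorbs-Π : ∀ {y} (f : A → Carrier) xs →
      (∀ x → Absorbs (f x) y) → Absorbs (Π (map f xs)) y
    absorbs-Π f []       p = *-identityʳ _
    absorbs-Π f (x ∷ xs) p = trans (sym (*-assoc _ _ _))
      (trans (*-congʳ (p x)) (absorbs-Π f xs p))

  -- One absorbing factor suffices for a product.
  *-absorbsˡ : ∀ {s x} y → Absorbs s x → Absorbs s (x * y)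
  *-absorbsˡ y p = trans (xy∙z≈xz∙y _ y _) (*-congʳ p)

  *-absorbsʳ : ∀ {s} x {y} → Absorbs s y → Absorbs s (x * y)
  *-absorbsʳ x p = trans (*-assoc x _ _) (*-congˡ p)

  Π-absorbs-factor : Idempotent _≈_ _*_ →
    ∀ {x xs} → x ∈ xs → Absorbs x (Π xs)
  Π-absorbs-factor idem (here refl)          = *-absorbsˡ _ (idem _)
  Π-absorbs-factor idem {xs = y ∷ _} (there x∈xs) =
    *-absorbsʳ y (Π-absorbs-factor idem x∈xs)

  -- Expanding a product of binary sums: each interpretation chooses one
  -- summand from every factor.
  Π-expand : ∀ k (f : Fin k → Bool → Carrier) →
    Σ (map (λ I → Π (tabulate (λ v → f v (Vec.lookup I v)))) (allInterpretations k))
      ≈ Π (tabulate (λ v → f v true + f v false))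
  Π-expand zero    f = +-identityʳ 1#
  Π-expand (suc k) f = begin
    Σ (map term (map (true Vec.∷_) Is ++ map (false Vec.∷_) Is ++ []))
      ≡⟨ cong (λ xs → Σ (map term (map (true Vec.∷_) Is ++ xs))) (++-identityʳ _) ⟩
    Σ (map term (map (true Vec.∷_) Is ++ map (false Vec.∷_) Is))
      ≈⟨ Σ-++ term (map (true Vec.∷_) Is) _ ⟩
    Σ (map term (map (true Vec.∷_) Is)) + Σ (map term (map (false Vec.∷_) Is))
      ≈⟨ +-cong (factor true) (factor false) ⟩
    f zero true * rest + f zero false * rest
      ≈⟨ distribʳ rest _ _ ⟨
    (f zero true + f zero false) * rest ∎
    where
    Is = allInterpretations k
    rest = Π (tabulate (λ v → f (suc v) true + f (suc v) false))

    term : Interpretation (suc k) → Carrier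
    term I = Π (tabulate (λ v → f v (Vec.lookup I v)))

    factor : ∀ b → Σ (map term (map (b Vec.∷_) Is)) ≈ f zero b * rest
    factor b = begin
      Σ (map term (map (b Vec.∷_) Is))      ≡⟨ cong Σ (map-∘ Is) ⟨
      Σ (map (λ I → f zero b * _) Is)       ≈⟨ Σ-distribˡ (f zero b) _ Is ⟨
      f zero b * Σ (map _ Is)               ≈⟨ *-congˡ (Π-expand k (f ∘ suc)) ⟩
      f zero b * rest                       ∎

-- Weights of interpretations

module Evaluation {c ℓ} (𝒜 : CommutativeSemiring c ℓ) {k : ℕ}
                  (α : Literal k → CommutativeSemiring.Carrier 𝒜) where
  open CommutativeSemiring 𝒜 hiding (zero; refl)
  open AMC 𝒜 α
  open SumsAndProducts 𝒜
  open SetoidReasoning setoid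

  -- The product of the labels of the literals in I.
  weight : Interpretation k → Carrier
  weight I = product (map α (literals I))

  -- The ⊕-sum of the labels of v and ¬v, that is, the value of v ∨ ¬v.
  tautology : Fin k → Carrier
  tautology v = α (pos v) + α (neg v)

  -- The value of the subcircuit rooted at a given node.
  value : ∀ {n} → DAG k n → Fin n → Carrier
  value = bottomUp evalStep

  sum-weights :
    Σ (map weight (allInterpretations k)) ≈ Π (map tautology (allFin k))
  sum-weights = begin
    Σ (map weight (allInterpretations k))
      ≡⟨ cong Σ (map-cong weight≡ (allInterpretations k)) ⟩
    Σ (map (λ I → Π (tabulate (λ v → choose v (Vec.lookup I v)))) (allInterpretations k))
      ≈⟨ Π-expand k choose ⟩
    Π (tabulate tautology)
      ≡⟨ cong Π (map-tabulate id tautology) ⟨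
    Π (map tautology (allFin k)) ∎
    where
    choose : Fin k → Bool → Carrier
    choose v b = α (if b then pos v else neg v)

    weight≡ : ∀ I → weight I ≡ Π (tabulate (λ v → choose v (Vec.lookup I v)))
    weight≡ I = cong Π (≡.trans (≡.sym (map-∘ (allFin k))) (map-tabulate id _))

  neutral-absorbs : Neutral → ∀ x v → Absorbs (tautology v) x
  neutral-absorbs neutral x v = trans (*-congˡ (neutral v)) (*-identityʳ x)

  -- Multiplication by a weight evaluates circuits

  module _ (*-idem : Idempotent _≈_ _*_) (consistent : ConsistencyPreserving) where

    weight-absorbs : ∀ I v →
      Absorbs (α (if Vec.lookup I v then pos v else neg v)) (weight I)
    weight-absorbs I v =
      Π-absorbs-factor *-idem (∈-map⁺ α (∈-map⁺ _ (∈-allFin v)))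

    absorbs-annihilates : ∀ {x y z} → Absorbs y x → y * z ≈ 0# → x * z ≈ 0#
    absorbs-annihilates {x} {y} {z} xy≈x yz≈0 = begin
      x * z        ≈⟨ *-congʳ xy≈x ⟨
      (x * y) * z  ≈⟨ *-assoc x y z ⟩
      x * (y * z)  ≈⟨ *-congˡ yz≈0 ⟩
      x * 0#       ≈⟨ zeroʳ x ⟩
      0#           ∎

    weight-pos : ∀ I v → weight I * α (pos v) ≈ [ Vec.lookup I v ] weight I
    weight-pos I v with Vec.lookup I v | weight-absorbs I v
    ... | true  | absorbs = absorbs
    ... | false | absorbs =
      absorbs-annihilates absorbs (trans (*-comm _ _) (consistent v))

    weight-neg : ∀ I v →
      weight I * α (neg v) ≈ [ Bool.not (Vec.lookup I v) ] weight I
    weight-neg I v with Vec.lookup I v | weight-absorbs I v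
    ... | true  | absorbs = absorbs-annihilates absorbs (consistent v)
    ... | false | absorbs = absorbs

    -- Multiplying the value x by the weight of I decides φ at I.
    Decides : Interpretation k → Formula k → Carrier → Set ℓ
    Decides I φ x = weight I * x ≈ [ ⟦ φ ⟧ I ] weight I

    module _ {a} {A : Set a} (F : A → Formula k) (e : A → Carrier) (I : Interpretation k) where

      decides-⋀ : ∀ {xs} → All (λ x → Decides I (F x) (e x)) xs →
        Decides I (foldr _∧_ ⊤ (map F xs)) (Π (map e xs))
      decides-⋀ [] = *-identityʳ _
      decides-⋀ (_∷_ {x = x} {xs = xs} p ps) = begin
        weight I * (e x * Π (map e xs))        ≈⟨ *-assoc _ _ _ ⟨
        (weight I * e x) * Π (map e xs)        ≈⟨ *-congʳ p ⟩
        [ ⟦ F x ⟧ I ] weight I * Π (map e xs)  ≈⟨ bracket (⟦ F x ⟧ I) ⟩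
        [ ⟦ F x ⟧ I Bool.∧ φs ] weight I       ∎
        where
        φs = ⟦ foldr _∧_ ⊤ (map F xs) ⟧ I
        bracket : ∀ b → [ b ] weight I * Π (map e xs) ≈ [ b Bool.∧ φs ] weight I
        bracket true  = decides-⋀ ps
        bracket false = zeroˡ _

      decides-⋁ : ∀ {xs} →
        Idempotent _≈_ _+_ ⊎ AllPairs Inconsistent (map F xs) →
        All (λ x → Decides I (F x) (e x)) xs →
        Decides I (foldr _∨_ ⊥ (map F xs)) (Σ (map e xs))
      decides-⋁ _ [] = zeroʳ _
      decides-⋁ h (_∷_ {x = x} {xs = xs} p ps) = begin
        weight I * (e x + Σ (map e xs))               ≈⟨ distribˡ _ _ _ ⟩
        weight I * e x + weight I * Σ (map e xs)      ≈⟨ +-cong p (decides-⋁ (tail h) ps) ⟩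
        [ ⟦ F x ⟧ I ] weight I + [ φs ] weight I      ≈⟨ bracket h ⟩
        [ ⟦ F x ⟧ I Bool.∨ φs ] weight I              ∎
        where
        φs = ⟦ foldr _∨_ ⊥ (map F xs) ⟧ I

        tail : Idempotent _≈_ _+_ ⊎ AllPairs Inconsistent (map F (x ∷ xs)) →
               Idempotent _≈_ _+_ ⊎ AllPairs Inconsistent (map F xs)
        tail = Sum.map₂ λ { (_ ∷ incs) → incs }

        bracket : Idempotent _≈_ _+_ ⊎ AllPairs Inconsistent (map F (x ∷ xs)) →
          [ ⟦ F x ⟧ I ] weight I + [ φs ] weight I ≈ [ ⟦ F x ⟧ I Bool.∨ φs ] weight I
        bracket h with ⟦ F x ⟧ I in Fx≡ | φs in φs≡
        ... | false | _     = +-identityˡ _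
        ... | true  | false = +-identityʳ _
        bracket (inj₁ +-idem)     | true | true = +-idem _
        -- At most one disjunct holds at I, so this case cannot occur.
        bracket (inj₂ (inc ∷ _)) | true | true =
          contradiction (≡.trans (≡.sym φs≡) (inconsistent-⋁ (F x) I inc Fx≡)) λ ()

    -- The assumption asks, at each disjunction node, for whichever of the two
    -- properties prevents repeated weights from accumulating.
    weight-eval : ∀ {n} (G : DAG k n) →
      (∀ i → labelOf G i ≡ or →
        Idempotent _≈_ _+_ ⊎ AllPairs Inconsistent (map (formula G) (children G i))) →
      ∀ I i → Decides I (formula G i) (value G i)
    weight-eval G h I = dag-induction G _ step
      where
      step : ∀ i → All (λ j → Decides I (formula G j) (value G j)) (children G i) →
             Decides I (formula G i) (value G i)
      step i ih
        rewrite bottomUp-unfold formulaStep G i | bottomUp-unfold evalStep G i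
        with labelOf G i in label≡
      ... | ⊤               = *-identityʳ _
      ... | ⊥               = zeroʳ _
      ... | literal (pos v) = weight-pos I v
      ... | literal (neg v) = weight-neg I v
      ... | or              = decides-⋁ _ _ I (h i label≡) ih
      ... | and             = decides-⋀ _ _ I ih

    -- Absorption at smooth circuits

    pos-absorbs : ∀ v → Absorbs (tautology v) (α (pos v))
    pos-absorbs v = begin
      α (pos v) * (α (pos v) + α (neg v))              ≈⟨ distribˡ _ _ _ ⟩
      α (pos v) * α (pos v) + α (pos v) * α (neg v)    ≈⟨ +-cong (*-idem _) (consistent v) ⟩
      α (pos v) + 0#                                   ≈⟨ +-identityʳ _ ⟩
      α (pos v)                                        ∎

    neg-absorbs : ∀ v → Absorbs (tautology v) (α (neg v))
    neg-absorbs v = begin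
      α (neg v) * (α (pos v) + α (neg v))              ≈⟨ distribˡ _ _ _ ⟩
      α (neg v) * α (pos v) + α (neg v) * α (neg v)    ≈⟨ +-cong (trans (*-comm _ _) (consistent v)) (*-idem _) ⟩
      0# + α (neg v)                                   ≈⟨ +-identityˡ _ ⟩
      α (neg v)                                        ∎

    -- The value x absorbs v ∨ ¬v for every variable v mentioned by φ.
    AbsorbsVars : Formula k → Carrier → Set ℓ
    AbsorbsVars φ x = ∀ v → v Subset.∈ vars φ → Absorbs (tautology v) x

    absorbsVars-⋀ : ∀ {a} {A : Set a} (F : A → Formula k) (e : A → Carrier) {xs} →
      All (λ x → AbsorbsVars (F x) (e x)) xs →
      AbsorbsVars (foldr _∧_ ⊤ (map F xs)) (Π (map e xs))
    absorbsVars-⋀ F e []                      v v∈ = contradiction v∈ ∉⊥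
    absorbsVars-⋀ F e (_∷_ {x = x} p ps) v v∈ with x∈p∪q⁻ (vars (F x)) _ v∈
    ... | inj₁ v∈x  = *-absorbsˡ _ (p v v∈x)
    ... | inj₂ v∈xs = *-absorbsʳ (e x) (absorbsVars-⋀ F e ps v v∈xs)

    absorbsVars-⋁ : ∀ {a} {A : Set a} (F : A → Formula k) (e : A → Carrier) {xs} →
      (∀ {x y} → x ∈ xs → y ∈ xs → vars (F x) ≡ vars (F y)) →
      All (λ x → AbsorbsVars (F x) (e x)) xs →
      AbsorbsVars (foldr _∨_ ⊥ (map F xs)) (Σ (map e xs))
    absorbsVars-⋁ F e {xs} same ps v v∈ with ∈-vars-⋁ F xs v∈
    ... | x , x∈xs , v∈x = Σ-absorbs e (All.tabulate λ y∈xs →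
      All.lookup ps y∈xs v (subst (v Subset.∈_) (same x∈xs y∈xs) v∈x))

    smooth-absorbs : (N : NNF k) → Smooth N →
      ∀ i → AbsorbsVars (formula (NNF.dag N) i) (value (NNF.dag N) i)
    smooth-absorbs N smooth = dag-induction G _ step
      where
      G = NNF.dag N

      step : ∀ i → All (λ j → AbsorbsVars (formula G j) (value G j)) (children G i) →
             AbsorbsVars (formula G i) (value G i)
      step i ih v v∈
        rewrite bottomUp-unfold formulaStep G i | bottomUp-unfold evalStep G i
        with labelOf G i in label≡
      ... | ⊤   = contradiction v∈ ∉⊥
      ... | ⊥   = zeroˡ _
      ... | or  = absorbsVars-⋁ (formula G) _ (smooth i label≡) ih v v∈
      ... | and = absorbsVars-⋀ (formula G) _ ih v v∈
      ... | literal (pos u) with refl ← x∈⁅y⁆⇒x≡y u v∈ = pos-absorbs u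
      ... | literal (neg u) with refl ← x∈⁅y⁆⇒x≡y u v∈ = neg-absorbs u

    -- From weights to the model count

    eval-amc : (T : Theory k) (N : NNF k) → Represents N T →
      Idempotent _≈_ _+_ ⊎ Deterministic N →
      (∀ v → Absorbs (tautology v) (eval N)) →
      eval N ≈ amc T
    eval-amc T N represents h absorbs = begin
      eval N                                       ≈⟨ absorbs-Π tautology (allFin k) absorbs ⟨
      eval N * Π (map tautology (allFin k))        ≈⟨ *-congˡ sum-weights ⟨
      eval N * Σ (map weight Is)                   ≈⟨ Σ-distribˡ (eval N) weight Is ⟩
      Σ (map (λ I → eval N * weight I) Is)         ≈⟨ Σ-cong at Is ⟩
      Σ (map (λ I → [ ⟦ T ⟧ᵀ I ] weight I) Is)     ≈⟨ Σ-filter ⟦ T ⟧ᵀ weight Is ⟨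
      amc T                                        ∎
      where
      Is = allInterpretations k

      at : ∀ I → eval N * weight I ≈ [ ⟦ T ⟧ᵀ I ] weight I
      at I = begin
        eval N * weight I
          ≈⟨ *-comm _ _ ⟩
        weight I * eval N
          ≈⟨ weight-eval (NNF.dag N) (λ i or≡ → Sum.map₂ (λ det → det i or≡) h) I zero ⟩
        [ ⟦ rootFormula N ⟧ I ] weight I
          ≡⟨ cong ([_] weight I) (represents I) ⟩
        [ ⟦ T ⟧ᵀ I ] weight I ∎

theorem7 : ∀ {c ℓ} (𝒜 : CommutativeSemiring c ℓ) {k : ℕ}
    (α : Literal k → CommutativeSemiring.Carrier 𝒜)
    (T : Theory k) (N : NNF k) →
    let open CommutativeSemiring 𝒜
        open AMC 𝒜 α
    in Idempotent _≈_ _*_ →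
       ConsistencyPreserving →
       Represents N T →
       (Smooth N × MentionsAllVariables N × Idempotent _≈_ _+_)
       ⊎ (Deterministic N × Neutral)
       ⊎ (Idempotent _≈_ _+_ × Neutral) →
       eval N ≈ amc T
theorem7 𝒜 α T N *-idem consistent represents = λ where
    (inj₁ (smooth , full , +-idem)) → conclude (inj₁ +-idem) λ v →
      smooth-absorbs *-idem consistent N smooth zero v
        (subst (v Subset.∈_) (≡.sym full) ∈⊤)
    (inj₂ (inj₁ (det , neutral)))    →
      conclude (inj₂ det) (neutral-absorbs neutral _)
    (inj₂ (inj₂ (+-idem , neutral))) →
      conclude (inj₁ +-idem) (neutral-absorbs neutral _)
  where
  open Evaluation 𝒜 α
  conclude = eval-amc *-idem consistent T N represents
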